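{- Let $\pi\colon \mathsf{States}\to\mathbb{R}_{\ge 0}$ be a potential function. For every program $C$ of the heap-manipulating probabilistic guarded command language and every $X\in\mathbb{A}_\pi$, $$\mathsf{aert}_\pi[\![C]\!](X) \;=\; \mathsf{ert}[\![C]\!](X+\pi)\;-\;\pi .$$
   Context: States and programs. Fix a finite set $\mathrm{Vars}$ of variables; values are $\mathbb{N}$, locations are $\mathbb{N}_{>0}$. A stack is $s\colon \mathrm{Vars}\to\mathbb{N}$; a heap is a partial map $h$ from a finite set $\mathrm{dom}(h)\subseteq\mathbb{N}_{>0}$ to $\mathbb{N}$. $h_1\perp h_2$ means disjoint domains; then $h_1\star h_2$ is their union; $h_\emptyset$ is the empty heap. $\mathsf{States}$ is the set of pairs $(s,h)$. $s(e)$ is the value of a (heap-independent) arithmetic expression $e$ under $s$, $s\models\varphi$ means the Boolean expression $\varphi$ holds under $s$, $s[x\mapsto v]$ is the updated stack, $h[\ell\mapsto v]$ (for $\ell\in\mathrm{dom}(h)$) the updated heap. Programs are generated by $C ::= \mathtt{tick}(e) \mid x:=e \mid x:=\mathtt{alloc}(e) \mid \langle e\rangle:=e' \mid x:=\langle e\rangle \mid \mathtt{free}(e) \mid \{C\}[p]\{C\} \mid \mathtt{if}(\varphi)\{C\}\mathtt{else}\{C\} \mid C;C \mid \mathtt{while}(\varphi)\{C\}$, where $p$ is an expression with $s(p)\in[0,1]\cap\mathbb{Q}$ for all $s$. The statements other than tick, probabilistic choice, conditional, sequencing and loops are called atomic. Runtimes. $\mathbb{T}$ is the set of functions $\mathsf{States}\to[0,\infty]$,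 ordered pointwise by $\preceq$; arithmetic is pointwise with $0\cdot\infty=0$. $[\varphi]$ is the $0/1$-valued Iverson bracket of a Boolean expression. Truncated subtraction: $a\dot- b=\max(a-b,0)$, $\infty\dot- b=\infty$ for finite $b$, $a\dot-\infty=0$. Separating sum: $(f\oplus g)(s,h)=\min\{f(s,h_1)+g(s,h_2)\mid h=h_1\star h_2\}$. Separating monus: $(f \mathbin{ -\!\!\ominus} g)(s,h)=\sup\{g(s,h\star h')\dot- f(s,h')\mid h'\perp h\}$. Quantifiers: $(\inf y\colon f)(s,h)=\inf_{v\in\mathbb{N}} f(s[y\mapsto v],h)$ and $(\sup y\colon f)(s,h)=\sup_{v\in\mathbb{N}}f(s[y\mapsto v],h)$. Substitution: $f[x/e](s,h)=f(s[x\mapsto s(e)],h)$. Atomic runtimes: $\mathsf{tm}(e)(s,h)=s(e)$ if $h=h_\emptyset$, else $\infty$; $[e\mapsto e'](s,h)=0$ if $\mathrm{dom}(h)=\{s(e)\}$ and $h(s(e))=s(e')$, else $\infty$; $[e\mapsto -](s,h)=0$ if $\mathrm{dom}(h)=\{s(e)\}$, else $\infty$; $\bigoplus_{i=1}^{e} f_i$ is evaluated at $(s,h)$ as the separating sum over $i=1,\dots,s(e)$ (the empty one being $[\mathsf{emp}]$, which is $0$ if $h=h_\emptyset$ and $\infty$ otherwise). Expected runtime transformer $\mathsf{ert}[\![C]\!]\colon\mathbb{T}\to\mathbb{T}$, by induction on $C$ (with $v$ a fresh variable): $\mathsf{ert}[\![\mathtt{tick}(e)]\!](f)=\mathsf{tm}(e)\oplus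 f$; $\mathsf{ert}[\![x:=e]\!](f)=f[x/e]$; $\mathsf{ert}[\![x:=\mathtt{alloc}(e)]\!](f)=\sup v\colon \big(\bigoplus_{i=1}^{e}[v+i-1\mapsto 0]\big)\mathbin{ -\!\!\ominus} f[x/v]$; $\mathsf{ert}[\![\langle e\rangle:=e']\!](f)=[e\mapsto-]\oplus([e\mapsto e']\mathbin{ -\!\!\ominus} f)$; $\mathsf{ert}[\![x:=\langle e\rangle]\!](f)=\inf v\colon [e\mapsto v]\oplus([e\mapsto v]\mathbin{ -\!\!\ominus} f[x/v])$; $\mathsf{ert}[\![\mathtt{free}(e)]\!](f)=[e\mapsto-]\oplus f$; $\mathsf{ert}[\![C_1;C_2]\!](f)=\mathsf{ert}[\![C_1]\!](\mathsf{ert}[\![C_2]\!](f))$; $\mathsf{ert}[\![\mathtt{if}(\varphi)\{C_1\}\mathtt{else}\{C_2\}]\!](f)=[\varphi]\cdot\mathsf{ert}[\![C_1]\!](f)+[\neg\varphi]\cdot\mathsf{ert}[\![C_2]\!](f)$; $\mathsf{ert}[\![\{C_1\}[p]\{C_2\}]\!](f)=p\cdot\mathsf{ert}[\![C_1]\!](f)+(1-p)\cdot\mathsf{ert}[\![C_2]\!](f)$; $\mathsf{ert}[\![\mathtt{while}(\varphi)\{C\}]\!](f)=\mathrm{lfp}\, g.\ [\neg\varphi]\cdot f+[\varphi]\cdot\mathsf{ert}[\![C]\!](g)$ (least fixed point in $(\mathbb{T},\preceq)$). Amortized runtimes. A potential function is $\pi\colon\mathsf{States}\to\mathbb{R}_{\ge0}$.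 $\mathbb{A}_\pi=\{X\colon\mathsf{States}\to\mathbb{R}\cup\{\infty\}\mid -\pi\le X \text{ pointwise}\}$, ordered pointwise by $\preceq$ (a complete lattice with least element $-\pi$). The transformer $\mathsf{aert}_\pi[\![C]\!]\colon\mathbb{A}_\pi\to\mathbb{A}_\pi$ is defined by: $\mathsf{aert}_\pi[\![\mathtt{tick}(e)]\!](X)=e+X$; for atomic $C$ other than tick, $\mathsf{aert}_\pi[\![C]\!](X)=\mathsf{ert}[\![C]\!](X+\pi)-\pi$; $\mathsf{aert}_\pi[\![C_1;C_2]\!](X)=\mathsf{aert}_\pi[\![C_1]\!](\mathsf{aert}_\pi[\![C_2]\!](X))$; conditional: $[\varphi]\cdot\mathsf{aert}_\pi[\![C_1]\!](X)+[\neg\varphi]\cdot\mathsf{aert}_\pi[\![C_2]\!](X)$; probabilistic choice: $p\cdot\mathsf{aert}_\pi[\![C_1]\!](X)+(1-p)\cdot\mathsf{aert}_\pi[\![C_2]\!](X)$; $\mathsf{aert}_\pi[\![\mathtt{while}(\varphi)\{C'\}]\!](X)=\mathrm{lfp}\,Y.\ [\neg\varphi]\cdot X+[\varphi]\cdot\mathsf{aert}_\pi[\![C']\!](Y)$ (least fixed point in $(\mathbb{A}_\pi,\preceq)$). -}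

module Defs where

open import Algebra.Bundles using (CommutativeRing)
open import Algebra.Structures using (IsCommutativeRing)
open import Axiom.ExcludedMiddle using (ExcludedMiddle)
open import Data.Bool.Base using (Bool; true; false; not)
open import Data.Empty using (⊥-elim)
open import Data.Fin.Base using (Fin)
open import Data.Integer.Base as ℤ using (ℤ; +_; -[1+_])
import Data.Integer.Properties as ℤₚ
open import Data.Maybe.Base using (Maybe; just; nothing; _<∣>_)
open import Data.Maybe.Properties using (just-injective)
open import Data.Nat.Base as ℕ using (ℕ; zero; suc)
import Data.Nat.Properties as ℕₚ
open import Data.Product.Base using (Σ; Σ-syntax; ∃; ∃-syntax; _×_; _,_; proj₁; proj₂)
open import Data.Rational.Base as ℚ using (ℚ; 0ℚ; 1ℚ; ↥_; ↧_; ↧ₙ_)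
import Data.Rational.Properties as ℚₚ
open import Data.Sum.Base using (_⊎_; inj₁; inj₂)
open import Data.Vec.Base using (Vec; lookup; _[_]≔_)
open import Function.Base using (_∘_)
open import Function.Bundles using (_⇔_)
open import Level using (0ℓ)
open import Relation.Binary.Bundles using (TotalOrder)
open import Relation.Binary.Core using (Rel)
open import Relation.Binary.Definitions using (tri<; tri≈; tri>)
open import Relation.Binary.PropositionalEquality as ≡ using (_≡_; _≢_; refl)
open import Relation.Binary.Structures using (IsTotalOrder)
open import Relation.Nullary using (¬_; yes; no; recompute)
open import Relation.Nullary.Construct.Add.Supremum using (_⁺; ⊤⁺; [_])

-- The standard library has no real numbers.  They are axiomatised here as a
-- Dedekind-complete totally ordered field, which classically determines them
-- up to isomorphism.  Equality is the setoid equality _≈_.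

record CompleteOrderedField : Set₁ where
  infix  4 _≈_ _≤_
  infixl 6 _+_
  infixl 7 _*_
  infix  8 -_
  field
    Carrier           : Set
    _≈_ _≤_           : Rel Carrier 0ℓ
    _+_ _*_           : Carrier → Carrier → Carrier
    -_                : Carrier → Carrier
    0# 1#             : Carrier
    isCommutativeRing : IsCommutativeRing _≈_ _+_ _*_ -_ 0# 1#
    isTotalOrder      : IsTotalOrder _≈_ _≤_
    0≉1               : ¬ (0# ≈ 1#)
    inverse           : ∀ x → ¬ (x ≈ 0#) → ∃[ y ] x * y ≈ 1#
    +-monoʳ-≤         : ∀ z {x y} → x ≤ y → z + x ≤ z + y
    *-nonneg          : ∀ {x y} → 0# ≤ x → 0# ≤ y → 0# ≤ x * y

  UpperBound : (Carrier → Set) → Carrier → Set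
  UpperBound S b = ∀ x → S x → x ≤ b

  field
    complete : (S : Carrier → Set) → ∃ S → ∃ (UpperBound S) →
               ∃[ s ] UpperBound S s × (∀ b → UpperBound S b → s ≤ b)

  commutativeRing : CommutativeRing 0ℓ 0ℓ
  commutativeRing = record { isCommutativeRing = isCommutativeRing }

  totalOrder : TotalOrder 0ℓ 0ℓ 0ℓ
  totalOrder = record { isTotalOrder = isTotalOrder }

-- A finite partial map from locations > k to ℕ, listed with strictly
-- increasing locations.  The order proofs are irrelevant, so two such maps with
-- the same graph are propositionally equal (`get-injective`).
data HeapAbove (k : ℕ) : Set where
  []   : HeapAbove k
  cell : (l v : ℕ) → .(k ℕ.< l) → HeapAbove l → HeapAbove k

Heap : Set
Heap = HeapAbove 0

∅ : Heap
∅ = []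

get : ∀ {k} → HeapAbove k → ℕ → Maybe ℕ
get []              l = nothing
get (cell l′ v _ h) l with l ℕₚ.≟ l′
... | yes _ = just v
... | no  _ = get h l

infix 4 _∈dom_ _⊥ₕ_

_∈dom_ : ∀ {k} → ℕ → HeapAbove k → Set
l ∈dom h = ∃[ v ] get h l ≡ just v

_⊥ₕ_ : Heap → Heap → Set
h₁ ⊥ₕ h₂ = ∀ l → ¬ (l ∈dom h₁ × l ∈dom h₂)

insert : ∀ {k} (l v : ℕ) → .(k ℕ.< l) → HeapAbove k → HeapAbove k
insert l v k<l [] = cell l v k<l []
insert l v k<l (cell l′ v′ k<l′ h) with ℕₚ.<-cmp l l′
... | tri< l<l′ _ _ = cell l v k<l (cell l′ v′ l<l′ h)
... | tri≈ _ _ _    = cell l′ v k<l′ h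
... | tri> _ _ l′<l = cell l′ v′ k<l′ (insert l v l′<l h)

-- Union of heaps, biased to the left where the domains overlap.
infixr 6 _⋆_
_⋆_ : ∀ {k} → HeapAbove k → Heap → Heap
[]             ⋆ h′ = h′
cell l v k<l h ⋆ h′ = insert l v (ℕₚ.≤-<-trans ℕ.z≤n k<l) (h ⋆ h′)

get-here : ∀ {k} l v .(p : k ℕ.< l) (h : HeapAbove l) → get (cell l v p h) l ≡ just v
get-here l v p h with l ℕₚ.≟ l
... | yes _  = refl
... | no l≢l = ⊥-elim (l≢l refl)

get-there : ∀ {k} l v .(p : k ℕ.< l) (h : HeapAbove l) {m} → m ≢ l →
            get (cell l v p h) m ≡ get h m
get-there l v p h {m} m≢l with m ℕₚ.≟ l
... | yes m≡l = ⊥-elim (m≢l m≡l)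
... | no _    = refl

get-≤ : ∀ {k} (h : HeapAbove k) {l} → l ℕ.≤ k → get h l ≡ nothing
get-≤ [] _ = refl
get-≤ {k} (cell l′ v p h) {l} l≤k = ≡.trans
  (get-there l′ v p h (λ { refl → ℕₚ.<⇒≱ k<l′ l≤k })) (get-≤ h (ℕₚ.≤-trans l≤k (ℕₚ.<⇒≤ k<l′)))
  where k<l′ = recompute (k ℕₚ.<? l′) p

just≢nothing : ∀ {v : ℕ} {x y : Maybe ℕ} → x ≡ just v → y ≡ nothing → x ≢ y
just≢nothing refl refl ()

get-injective : ∀ {k} (h h′ : HeapAbove k) → (∀ l → get h l ≡ get h′ l) → h ≡ h′
get-injective [] [] _ = refl
get-injective [] (cell l v p h) eq = ⊥-elim (just≢nothing (get-here l v p h) refl (≡.sym (eq l)))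
get-injective (cell l v p h) [] eq = ⊥-elim (just≢nothing (get-here l v p h) refl (eq l))
get-injective {k} (cell l v p h) (cell l′ v′ p′ h′) eq with ℕₚ.<-cmp l l′
... | tri< l<l′ l≢l′ _ = ⊥-elim (just≢nothing (get-here l v p h)
        (≡.trans (get-there l′ v′ p′ h′ l≢l′) (get-≤ h′ (ℕₚ.<⇒≤ l<l′))) (eq l))
... | tri> _ l≢l′ l′<l = ⊥-elim (just≢nothing (get-here l′ v′ p′ h′)
        (≡.trans (get-there l v p h (l≢l′ ∘ ≡.sym)) (get-≤ h (ℕₚ.<⇒≤ l′<l))) (≡.sym (eq l′)))
... | tri≈ _ refl _ with just-injective (≡.trans (≡.sym (get-here l v p h))
                                                 (≡.trans (eq l) (get-here l v′ p′ h′)))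
...   | refl = ≡.cong (cell l v p) (get-injective h h′ tails)
  where
  tails : ∀ m → get h m ≡ get h′ m
  tails m with m ℕₚ.≟ l
  ... | yes refl = ≡.trans (get-≤ h ℕₚ.≤-refl) (≡.sym (get-≤ h′ ℕₚ.≤-refl))
  ... | no m≢l   = ≡.trans (≡.sym (get-there l v p h m≢l))
                           (≡.trans (eq m) (get-there l v p′ h′ m≢l))

get-insert-≡ : ∀ {k} l v .(p : k ℕ.< l) (h : HeapAbove k) → get (insert l v p h) l ≡ just v
get-insert-≡ l v p [] = get-here l v p []
get-insert-≡ l v p (cell l′ v′ p′ h) with ℕₚ.<-cmp l l′
... | tri< l<l′ _ _   = get-here l v p (cell l′ v′ l<l′ h)
... | tri≈ _ refl _   = get-here l v p′ h
... | tri> _ l≢l′ l′<l = ≡.trans (get-there l′ v′ p′ _ l≢l′) (get-insert-≡ l v l′<l h)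

get-insert-≢ : ∀ {k} l v .(p : k ℕ.< l) (h : HeapAbove k) {m} → m ≢ l →
               get (insert l v p h) m ≡ get h m
get-insert-≢ l v p [] m≢l = get-there l v p [] m≢l
get-insert-≢ l v p (cell l′ v′ p′ h) {m} m≢l with ℕₚ.<-cmp l l′
... | tri< l<l′ _ _ = get-there l v p (cell l′ v′ l<l′ h) m≢l
... | tri≈ _ refl _ = ≡.trans (get-there l v p′ h m≢l) (≡.sym (get-there l v′ p′ h m≢l))
... | tri> _ _ l′<l with m ℕₚ.≟ l′
...   | yes refl = refl
...   | no m≢l′  = get-insert-≢ l v l′<l h m≢l

get-⋆ : ∀ {k} (h : HeapAbove k) (h′ : Heap) l → get (h ⋆ h′) l ≡ (get h l <∣> get h′ l)
get-⋆ [] h′ l = refl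
get-⋆ (cell l′ v p h) h′ l with l ℕₚ.≟ l′
... | yes refl = get-insert-≡ l v (ℕₚ.≤-<-trans ℕ.z≤n p) (h ⋆ h′)
... | no l≢l′  = ≡.trans (get-insert-≢ l′ v (ℕₚ.≤-<-trans ℕ.z≤n p) (h ⋆ h′) l≢l′) (get-⋆ h h′ l)

-- Vars is the finite set Fin n.
module Syntax (n : ℕ) where

  Var : Set
  Var = Fin n

  Stack : Set
  Stack = Vec ℕ n

  State : Set
  State = Stack × Heap

  -- Expressions are heap-independent and are identified with their values.

  Expr : Set
  Expr = Stack → ℕ

  BExpr : Set
  BExpr = Stack → Bool

  record Probability : Set where
    field
      value : ℚ
      0≤p   : 0ℚ ℚ.≤ value
      p≤1   : value ℚ.≤ 1ℚ

  PExpr : Set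
  PExpr = Stack → Probability

  infix  6 _≔_ _≔alloc_ ⟨_⟩≔_ _≔⟨_⟩
  infixr 5 _⨾_

  data Program : Set where
    tick                 : Expr → Program
    _≔_                  : Var → Expr → Program
    _≔alloc_             : Var → Expr → Program
    ⟨_⟩≔_                : Expr → Expr → Program
    _≔⟨_⟩                : Var → Expr → Program
    free                 : Expr → Program
    ｛_｝⟦_⟧｛_｝           : Program → PExpr → Program → Program
    if_then_else_        : BExpr → Program → Program → Program
    _⨾_                  : Program → Program → Program
    while                : BExpr → Program → Program

-- Excluded middle is what makes infima in ℝ ∪ {∞} total functions (is some
-- member of the family finite?), and decides the side conditions on heaps.
module Runtimes (em : ExcludedMiddle 0ℓ) (𝓡 : CompleteOrderedField) (n : ℕ) where

  open Syntax n public

  open CompleteOrderedField 𝓡 renaming (Carrier to ℝ)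
  open CommutativeRing commutativeRing
    using (+-cong; +-assoc; +-comm; +-identityˡ; +-identityʳ; -‿inverseˡ; -‿inverseʳ;
           *-cong; *-assoc; *-comm; *-identityˡ; *-identityʳ; zeroˡ; zeroʳ; distribˡ; distribʳ;
           semiring; ring; setoid)
    renaming (refl to ≈-refl; sym to ≈-sym; trans to ≈-trans)
  open IsTotalOrder isTotalOrder
    using (≤-respˡ-≈; ≤-respʳ-≈; total)
    renaming (refl to ≤-refl; reflexive to ≤-reflexive; trans to ≤-trans; antisym to ≤-antisym)
  open import Algebra.Construct.NaturalChoice.Max totalOrder
    using (_⊔_; x≤x⊔y; x≤y⊔x; ⊔-mono-≤; ⊔-lub)
  open import Algebra.Properties.Ring ring using (-‿distribʳ-*; -1*x≈-x; -‿involutive)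
  open import Algebra.Properties.Semiring.Mult semiring using (×-homo-+) renaming (_×_ to _·_)
  open import Relation.Binary.Reasoning.Setoid setoid

  private
    infixl 6 _-_
    _-_ : ℝ → ℝ → ℝ
    x - y = x + - y

  +-mono-≤ : ∀ {w x y z} → w ≤ x → y ≤ z → w + y ≤ x + z
  +-mono-≤ {w} {x} {y} {z} w≤x y≤z = ≤-trans (+-monoʳ-≤ w y≤z)
    (≤-respˡ-≈ (+-comm z w) (≤-respʳ-≈ (+-comm z x) (+-monoʳ-≤ z w≤x)))

  +-nonneg : ∀ {x y} → 0# ≤ x → 0# ≤ y → 0# ≤ x + y
  +-nonneg p q = ≤-respˡ-≈ (+-identityˡ 0#) (+-mono-≤ p q)

  x-x+y : ∀ x y → x + (y - x) ≈ y
  x-x+y x y = begin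
    x + (y - x)   ≈⟨ +-cong ≈-refl (+-comm y (- x)) ⟩
    x + (- x + y) ≈⟨ +-assoc x (- x) y ⟨
    (x - x) + y   ≈⟨ +-cong (-‿inverseʳ x) ≈-refl ⟩
    0# + y        ≈⟨ +-identityˡ y ⟩
    y             ∎

  x≤y⇒0≤y-x : ∀ {x y} → x ≤ y → 0# ≤ y - x
  x≤y⇒0≤y-x {x} {y} p = ≤-respˡ-≈ (-‿inverseʳ x) (+-mono-≤ p ≤-refl)

  0≤y-x⇒x≤y : ∀ {x y} → 0# ≤ y - x → x ≤ y
  0≤y-x⇒x≤y {x} {y} p = ≤-respˡ-≈ (+-identityʳ x) (≤-respʳ-≈ (x-x+y x y) (+-monoʳ-≤ x p))

  -‿anti-≤ : ∀ {x y} → x ≤ y → - y ≤ - x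
  -‿anti-≤ {x} {y} p = 0≤y-x⇒x≤y
    (≤-respʳ-≈ (≈-trans (+-comm y (- x)) (+-cong ≈-refl (≈-sym (-‿involutive y)))) (x≤y⇒0≤y-x p))

  *-monoˡ-≤ : ∀ {w x y} → 0# ≤ w → x ≤ y → w * x ≤ w * y
  *-monoˡ-≤ {w} {x} {y} 0≤w p = 0≤y-x⇒x≤y (≤-respʳ-≈
    (≈-trans (distribˡ w y (- x)) (+-cong ≈-refl (≈-sym (-‿distribʳ-* w x))))
    (*-nonneg 0≤w (x≤y⇒0≤y-x p)))

  0≤1 : 0# ≤ 1#
  0≤1 with total 0# 1#
  ... | inj₁ p = p
  ... | inj₂ p = ≤-respʳ-≈ (begin
      - 1# * - 1# ≈⟨ -1*x≈-x (- 1#) ⟩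
      - (- 1#)    ≈⟨ -‿involutive 1# ⟩
      1#          ∎) (*-nonneg 0≤-1 0≤-1)
    where 0≤-1 = ≤-respʳ-≈ (+-identityˡ (- 1#)) (x≤y⇒0≤y-x p)

  fromℕ : ℕ → ℝ
  fromℕ m = m · 1#

  fromℤ : ℤ → ℝ
  fromℤ (+ m)    = fromℕ m
  fromℤ -[1+ m ] = - fromℕ (suc m)

  fromℕ-nonneg : ∀ m → 0# ≤ fromℕ m
  fromℕ-nonneg zero    = ≤-refl
  fromℕ-nonneg (suc m) = +-nonneg 0≤1 (fromℕ-nonneg m)

  fromℕ-suc≉0 : ∀ m → ¬ (fromℕ (suc m) ≈ 0#)
  fromℕ-suc≉0 m eq = 0≉1 (≤-antisym 0≤1
    (≤-respʳ-≈ eq (≤-respˡ-≈ (+-identityʳ 1#) (+-monoʳ-≤ 1# (fromℕ-nonneg m)))))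

  fromℕ-mono : ∀ {m k} → m ℕ.≤ k → fromℕ m ≤ fromℕ k
  fromℕ-mono {k = k} ℕ.z≤n = fromℕ-nonneg k
  fromℕ-mono (ℕ.s≤s p)     = +-monoʳ-≤ 1# (fromℕ-mono p)

  fromℤ-nonneg : ∀ {i} → ℤ.0ℤ ℤ.≤ i → 0# ≤ fromℤ i
  fromℤ-nonneg {+ m} _ = fromℕ-nonneg m

  recip : ∀ d → ∃[ y ] fromℕ (suc d) * y ≈ 1#
  recip d = inverse (fromℕ (suc d)) (fromℕ-suc≉0 d)

  recip-nonneg : ∀ d → 0# ≤ proj₁ (recip d)
  recip-nonneg d with total 0# (proj₁ (recip d))
  ... | inj₁ p = p
  ... | inj₂ p = ⊥-elim (0≉1 (≤-antisym 0≤1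
        (≤-respˡ-≈ (proj₂ (recip d)) (≤-respʳ-≈ (zeroʳ _) (*-monoˡ-≤ (fromℕ-nonneg (suc d)) p)))))

  fromℚ : ℚ → ℝ
  fromℚ q = fromℤ (↥ q) * proj₁ (inverse (fromℕ (↧ₙ q)) (fromℕ-suc≉0 (ℚ.denominator-1 q)))

  record ℝ≥0 : Set where
    constructor _,≥0_
    field
      ⌊_⌋    : ℝ
      nonneg : 0# ≤ ⌊_⌋

  open ℝ≥0 public

  0≤fromℚ : ∀ q → 0ℚ ℚ.≤ q → 0# ≤ fromℚ q
  0≤fromℚ q 0≤q = *-nonneg (fromℤ-nonneg 0≤↥q) (recip-nonneg (ℚ.denominator-1 q))
    where
    0≤↥q : ℤ.0ℤ ℤ.≤ ↥ q
    0≤↥q = ≡.subst₂ ℤ._≤_ (ℤₚ.*-zeroˡ (↧ q)) (ℤₚ.*-identityʳ (↥ q)) (ℚₚ.drop-*≤* 0≤q)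

  fromℚ≤1 : ∀ q → q ℚ.≤ 1ℚ → fromℚ q ≤ 1#
  fromℚ≤1 q q≤1 = ≤-respʳ-≈ (≈-trans (*-comm y d) (proj₂ (recip (ℚ.denominator-1 q))))
    (≤-respˡ-≈ (*-comm y (fromℤ (↥ q)))
      (*-monoˡ-≤ (recip-nonneg (ℚ.denominator-1 q)) (fromℤ-≤ (↥ q) ↥q≤↧q)))
    where
    y = proj₁ (recip (ℚ.denominator-1 q))
    d = fromℕ (↧ₙ q)
    ↥q≤↧q : ↥ q ℤ.≤ ↧ q
    ↥q≤↧q = ≡.subst₂ ℤ._≤_ (ℤₚ.*-identityʳ (↥ q)) (ℤₚ.*-identityˡ (↧ q)) (ℚₚ.drop-*≤* q≤1)
    fromℤ-≤ : ∀ i {m} → i ℤ.≤ + m → fromℤ i ≤ fromℕ m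
    fromℤ-≤ (+ k)    (ℤ.+≤+ p) = fromℕ-mono p
    fromℤ-≤ -[1+ k ] {m} _     = ≤-trans
      (≤-respʳ-≈ (≈-trans (≈-sym (+-identityˡ _)) (-‿inverseʳ 0#)) (-‿anti-≤ (fromℕ-nonneg (suc k))))
      (fromℕ-nonneg m)

  infix 9 1−_
  prob 1−_ : Probability → ℝ≥0
  prob p = fromℚ (value p) ,≥0 0≤fromℚ (value p) (0≤p p)
    where open Probability
  1− p   = (1# - fromℚ (value p)) ,≥0 x≤y⇒0≤y-x (fromℚ≤1 (value p) (p≤1 p))
    where open Probability

  iverson : Bool → ℝ≥0
  iverson true  = 1# ,≥0 0≤1
  iverson false = 0# ,≥0 ≤-refl

  prob-sum : ∀ p → ⌊ prob p ⌋ + ⌊ 1− p ⌋ ≈ 1#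
  prob-sum p = x-x+y ⌊ prob p ⌋ 1#

  iverson-sum : ∀ b → ⌊ iverson b ⌋ + ⌊ iverson (not b) ⌋ ≈ 1#
  iverson-sum true  = +-identityʳ 1#
  iverson-sum false = +-identityˡ 1#

  ℝ∞ : Set
  ℝ∞ = ℝ ⁺

  pattern ∞ = ⊤⁺

  open import Relation.Binary.Construct.Add.Supremum.Equality _≈_ public
    using (_≈⁺_; ⊤⁺≈⊤⁺; [_])
  open import Relation.Binary.Construct.Add.Supremum.NonStrict _≤_ public
    using (_≤⁺_; _≤⊤⁺; [_]; [≤]-injective; ≤⁺-trans; ≤⁺-reflexive; ≤⁺-antisym)

  infixl 6 _+⁺_
  _+⁺_ : ℝ∞ → ℝ∞ → ℝ∞
  [ x ] +⁺ [ y ] = [ x + y ]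
  [ x ] +⁺ ∞     = ∞
  ∞     +⁺ y     = ∞

  -- 0 · ∞ = 0
  infixl 7 _·⁺_
  _·⁺_ : ℝ≥0 → ℝ∞ → ℝ∞
  w ·⁺ [ x ] = [ ⌊ w ⌋ * x ]
  w ·⁺ ∞     with em {⌊ w ⌋ ≈ 0#}
  ... | yes _ = [ 0# ]
  ... | no  _ = ∞

  infixl 6 _∸⁺_
  _∸⁺_ : ℝ∞ → ℝ∞ → ℝ∞
  [ x ] ∸⁺ [ y ] = [ (x - y) ⊔ 0# ]
  ∞     ∸⁺ [ y ] = ∞
  x     ∸⁺ ∞     = [ 0# ]

  ≤⁺-refl : ∀ {x} → x ≤⁺ x
  ≤⁺-refl {[ x ]} = [ ≤-refl ]
  ≤⁺-refl {∞}     = ∞ ≤⊤⁺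

  +⁺-mono : ∀ {w x y z} → w ≤⁺ x → y ≤⁺ z → w +⁺ y ≤⁺ x +⁺ z
  +⁺-mono [ p ]     [ q ]     = [ +-mono-≤ p q ]
  +⁺-mono [ p ]     (y ≤⊤⁺)   = _ ≤⊤⁺
  +⁺-mono (w ≤⊤⁺)   q         = _ ≤⊤⁺

  ·⁺-mono : ∀ w {x y} → x ≤⁺ y → w ·⁺ x ≤⁺ w ·⁺ y
  ·⁺-mono w [ p ]       = [ *-monoˡ-≤ (nonneg w) p ]
  ·⁺-mono w (∞ ≤⊤⁺)     = ≤⁺-refl
  ·⁺-mono w ([ x ] ≤⊤⁺) with em {⌊ w ⌋ ≈ 0#}
  ... | yes w≈0 = [ ≤-reflexive (≈-trans (*-cong w≈0 ≈-refl) (zeroˡ x)) ]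
  ... | no _    = _ ≤⊤⁺

  ∸⁺-monoˡ : ∀ {x y} z → x ≤⁺ y → x ∸⁺ z ≤⁺ y ∸⁺ z
  ∸⁺-monoˡ [ z ] [ p ]       = [ ⊔-mono-≤ (+-mono-≤ p ≤-refl) ≤-refl ]
  ∸⁺-monoˡ [ z ] (x ≤⊤⁺)     = _ ≤⊤⁺
  ∸⁺-monoˡ ∞     [ p ]       = ≤⁺-refl
  ∸⁺-monoˡ ∞     ([ x ] ≤⊤⁺) = ≤⁺-refl
  ∸⁺-monoˡ ∞     (∞ ≤⊤⁺)     = ≤⁺-refl

  -- The interval [b,∞]; in particular [0,∞] is [ 0# ,∞].
  record [_,∞] (b : ℝ) : Set where
    constructor _,≥_
    field
      val   : ℝ∞
      bound : [ b ] ≤⁺ val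

  open [_,∞] public

  infix 4 _⊑_
  _⊑_ : ∀ {a b} → [ a ,∞] → [ b ,∞] → Set
  x ⊑ y = val x ≤⁺ val y

  infixl 6 _⊞_
  _⊞_ : [ 0# ,∞] → ∀ {b} → [ b ,∞] → [ b ,∞]
  x ⊞ y = (val x +⁺ val y)
    ,≥ ≤⁺-trans ≤-trans [ ≤-reflexive (≈-sym (+-identityˡ _)) ] (+⁺-mono (bound x) (bound y))

  infixl 6 _∸_
  _∸_ : [ 0# ,∞] → [ 0# ,∞] → [ 0# ,∞]
  x ∸ y = (val x ∸⁺ val y) ,≥ lemma (val x) (val y)
    where
    lemma : ∀ x y → [ 0# ] ≤⁺ x ∸⁺ y
    lemma [ x ] [ y ] = [ x≤y⊔x (x - y) 0# ]
    lemma ∞     [ y ] = _ ≤⊤⁺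
    lemma [ x ] ∞     = ≤⁺-refl
    lemma ∞     ∞     = ≤⁺-refl

  -- w · x + w′ · y; as w + w′ = 1 this stays in any [b,∞].
  mix : (w w′ : ℝ≥0) → ⌊ w ⌋ + ⌊ w′ ⌋ ≈ 1# → ∀ {b} → [ b ,∞] → [ b ,∞] → [ b ,∞]
  mix w w′ eq {b} x y = (w ·⁺ val x +⁺ w′ ·⁺ val y)
    ,≥ ≤⁺-trans ≤-trans [ ≤-reflexive (begin
         b                           ≈⟨ *-identityˡ b ⟨
         1# * b                      ≈⟨ *-cong eq ≈-refl ⟨
         (⌊ w ⌋ + ⌊ w′ ⌋) * b        ≈⟨ distribʳ b ⌊ w ⌋ ⌊ w′ ⌋ ⟩
         ⌊ w ⌋ * b + ⌊ w′ ⌋ * b      ∎) ]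
       (+⁺-mono (·⁺-mono w (bound x)) (·⁺-mono w′ (bound y)))

  LowerBound : ∀ {b} {I : Set} → (I → [ b ,∞]) → ℝ → Set
  LowerBound f x = ∀ i → [ x ] ≤⁺ val (f i)

  infimum : ∀ {b} {I : Set} (f : I → [ b ,∞]) → ∃[ i ] ∃[ r ] val (f i) ≡ [ r ] →
            ∃[ s ] UpperBound (LowerBound f) s × (∀ c → UpperBound (LowerBound f) c → s ≤ c)
  infimum {b} f (i , r , eq) = complete (LowerBound f) (b , λ i → bound (f i))
    (r , λ x lb → [≤]-injective (≡.subst ([ x ] ≤⁺_) eq (lb i)))

  -- Infimum of a family in [b,∞]: the largest real lower bound, or ∞ if no
  -- member of the family is finite.
  ⋀ : ∀ {b} {I : Set} → (I → [ b ,∞]) → [ b ,∞]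
  ⋀ {b} f with em {∃[ i ] ∃[ r ] val (f i) ≡ [ r ]}
  ... | yes e = [ proj₁ (infimum f e) ] ,≥ [ proj₁ (proj₂ (infimum f e)) b (λ i → bound (f i)) ]
  ... | no  _ = ∞ ,≥ (_ ≤⊤⁺)

  ⋀-lower : ∀ {b} {I : Set} (f : I → [ b ,∞]) i → ⋀ f ⊑ f i
  ⋀-lower f i with em {∃[ i ] ∃[ r ] val (f i) ≡ [ r ]} | val (f i) in eq
  ... | yes e | ∞     = _ ≤⊤⁺
  ... | yes e | [ r ] = [ proj₂ (proj₂ (infimum f e)) r
                            (λ x lb → [≤]-injective (≡.subst ([ x ] ≤⁺_) eq (lb i))) ]
  ... | no ¬e | ∞     = _ ≤⊤⁺
  ... | no ¬e | [ r ] = ⊥-elim (¬e (i , r , eq))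

  ⋀-greatest : ∀ {b} {I : Set} (f : I → [ b ,∞]) {c} (x : [ c ,∞]) → (∀ i → x ⊑ f i) → x ⊑ ⋀ f
  ⋀-greatest f x lb with em {∃[ i ] ∃[ r ] val (f i) ≡ [ r ]} | val x in eq
  ... | no _            | _     = _ ≤⊤⁺
  ... | yes e           | [ r ] = [ proj₁ (proj₂ (infimum f e)) r
                                      (λ i → lb i) ]
  ... | yes (i , r , q) | ∞     with ≡.subst (_ ≤⁺_) q (lb i)
  ...   | ()

  ⋁ : ∀ {b} {I : Set} → (I → [ b ,∞]) → [ b ,∞]
  ⋁ {b} {I} f = ⋀ {I = Σ[ u ∈ [ b ,∞] ] (∀ i → f i ⊑ u)} proj₁

  ⋁-upper : ∀ {b} {I : Set} (f : I → [ b ,∞]) i → f i ⊑ ⋁ f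
  ⋁-upper f i = ⋀-greatest proj₁ (f i) (λ (u , ub) → ub i)

  ⋁-least : ∀ {b} {I : Set} (f : I → [ b ,∞]) (u : [ b ,∞]) → (∀ i → f i ⊑ u) → ⋁ f ⊑ u
  ⋁-least f u ub = ⋀-lower proj₁ (u , ub)

  Above : (State → ℝ) → Set
  Above ℓ = ∀ σ → [ ℓ σ ,∞]

  infix 4 _≼_ _≐_

  _≼_ : ∀ {ℓ} → Above ℓ → Above ℓ → Set
  f ≼ g = ∀ σ → f σ ⊑ g σ

  _≐_ : ∀ {ℓ} → Above ℓ → Above ℓ → Set
  f ≐ g = ∀ σ → val (f σ) ≈⁺ val (g σ)

  Monotone : ∀ {ℓ ℓ′} → (Above ℓ → Above ℓ′) → Set
  Monotone Φ = ∀ f g → f ≼ g → Φ f ≼ Φ g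

  IsLeastFixedPoint : ∀ {ℓ} → (Above ℓ → Above ℓ) → Above ℓ → Set
  IsLeastFixedPoint Φ f = Φ f ≐ f × (∀ g → Φ g ≐ g → f ≼ g)

  -- The meet of all prefixed points.  For monotone Φ it is the least fixed
  -- point (`lfp-isLeastFixedPoint`); `ert-lfp` and `aert-lfp` below show that
  -- this covers the loops in the definitions of `ert` and `aert`.
  lfp : ∀ {ℓ} → (Above ℓ → Above ℓ) → Above ℓ
  lfp {ℓ} Φ σ = ⋀ {I = Σ[ g ∈ Above ℓ ] Φ g ≼ g} (λ (g , _) → g σ)

  lfp-isLeastFixedPoint : ∀ {ℓ} (Φ : Above ℓ → Above ℓ) → Monotone Φ → IsLeastFixedPoint Φ (lfp Φ)
  lfp-isLeastFixedPoint {ℓ} Φ mono =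
    (λ σ → ≤⁺-antisym ≤-antisym (pre σ) (post σ)) ,
    (λ g fix σ → ⋀-lower _ (g , λ τ → ≤⁺-reflexive ≤-reflexive (fix τ)))
    where
    pre : Φ (lfp Φ) ≼ lfp Φ
    pre σ = ⋀-greatest _ (Φ (lfp Φ) σ) λ (g , Φg≼g) →
      ≤⁺-trans ≤-trans (mono (lfp Φ) g (λ τ → ⋀-lower _ (g , Φg≼g)) σ) (Φg≼g σ)
    post : lfp Φ ≼ Φ (lfp Φ)
    post σ = ⋀-lower _ (Φ (lfp Φ) , mono (Φ (lfp Φ)) (lfp Φ) pre)

  [_]·_+[¬]·_ : ∀ {ℓ} → BExpr → Above ℓ → Above ℓ → Above ℓ
  ([ φ ]· f +[¬]· g) (s , h) =
    mix (iverson (φ s)) (iverson (not (φ s))) (iverson-sum (φ s)) (f (s , h)) (g (s , h))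

  _·_+[1−]·_ : ∀ {ℓ} → PExpr → Above ℓ → Above ℓ → Above ℓ
  (p · f +[1−]· g) (s , h) =
    mix (prob (p s)) (1− p s) (prob-sum (p s)) (f (s , h)) (g (s , h))

  𝕋 : Set
  𝕋 = Above (λ _ → 0#)

  infix 5 _or-∞-unless_
  _or-∞-unless_ : [ 0# ,∞] → Set → [ 0# ,∞]
  x or-∞-unless P with em {P}
  ... | yes _ = x
  ... | no  _ = ∞ ,≥ (_ ≤⊤⁺)

  0∞ : [ 0# ,∞]
  0∞ = [ 0# ] ,≥ ≤⁺-refl

  ℕ∞ : ℕ → [ 0# ,∞]
  ℕ∞ m = [ fromℕ m ] ,≥ [ fromℕ-nonneg m ]

  const : ℕ → Expr
  const m _ = m

  dom_is｛_｝ : Heap → ℕ → Set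
  dom h is｛ l ｝ = ∀ m → m ∈dom h ⇔ m ≡ l

  emp : 𝕋
  emp (s , h) = 0∞ or-∞-unless (h ≡ ∅)

  tm : Expr → 𝕋
  tm e (s , h) = ℕ∞ (e s) or-∞-unless (h ≡ ∅)

  [_↦_] : Expr → Expr → 𝕋
  [ e ↦ e′ ] (s , h) = 0∞ or-∞-unless (dom h is｛ e s ｝ × get h (e s) ≡ just (e′ s))

  [_↦-] : Expr → 𝕋
  [ e ↦-] (s , h) = 0∞ or-∞-unless dom h is｛ e s ｝

  infixr 5 _⊕_
  infixr 4 _−⊖_

  -- A heap has finitely many splittings, at least one, so the infimum is a
  -- minimum.
  _⊕_ : 𝕋 → 𝕋 → 𝕋
  (f ⊕ g) (s , h) =
    ⋀ {I = Σ[ h₁ ∈ Heap ] Σ[ h₂ ∈ Heap ] (h₁ ⊥ₕ h₂ × h ≡ h₁ ⋆ h₂)}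
      λ (h₁ , h₂ , _) → f (s , h₁) ⊞ g (s , h₂)

  _−⊖_ : 𝕋 → 𝕋 → 𝕋
  (f −⊖ g) (s , h) =
    ⋁ {I = Σ[ h′ ∈ Heap ] h′ ⊥ₕ h} λ (h′ , _) → g (s , h ⋆ h′) ∸ f (s , h′)

  -- The quantified variable is always fresh, hence not in Vars; it is
  -- represented by the argument of a family of runtimes.

  inf sup : (ℕ → 𝕋) → 𝕋
  inf F σ = ⋀ λ v → F v σ
  sup F σ = ⋁ λ v → F v σ

  infix 6 _[_/_]
  _[_/_] : 𝕋 → Var → Expr → 𝕋
  (f [ x / e ]) (s , h) = f (s [ x ]≔ e s , h)

  ⨁[_] : ℕ → (ℕ → 𝕋) → 𝕋
  ⨁[ zero  ] F = emp
  ⨁[ suc m ] F = ⨁[ m ] F ⊕ F (suc m)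

  ⨁ : Expr → (ℕ → 𝕋) → 𝕋
  ⨁ e F (s , h) = ⨁[ e s ] F (s , h)

  ert : Program → 𝕋 → 𝕋
  ert (tick e)               f = tm e ⊕ f
  ert (x ≔ e)                f = f [ x / e ]
  ert (x ≔alloc e)           f = sup λ v → ⨁ e (λ i → [ const (v ℕ.+ i ℕ.∸ 1) ↦ const 0 ])
                                           −⊖ f [ x / const v ]
  ert (⟨ e ⟩≔ e′)            f = [ e ↦-] ⊕ ([ e ↦ e′ ] −⊖ f)
  ert (x ≔⟨ e ⟩)             f = inf λ v → [ e ↦ const v ]
                                           ⊕ ([ e ↦ const v ] −⊖ f [ x / const v ])
  ert (free e)               f = [ e ↦-] ⊕ f
  ert (｛ C₁ ｝⟦ p ⟧｛ C₂ ｝)   f = p · ert C₁ f +[1−]· ert C₂ f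
  ert (if φ then C₁ else C₂) f = [ φ ]· ert C₁ f +[¬]· ert C₂ f
  ert (C₁ ⨾ C₂)              f = ert C₁ (ert C₂ f)
  ert (while φ C)            f = lfp λ g → [ φ ]· ert C g +[¬]· f

  Potential : Set
  Potential = State → ℝ≥0

  𝔸 : Potential → Set
  𝔸 π = Above (λ σ → - ⌊ π σ ⌋)

  infixl 6 addPotential _−ₚ_

  addPotential : (π : Potential) → 𝔸 π → 𝕋
  addPotential π X σ = (val (X σ) +⁺ [ ⌊ π σ ⌋ ])
    ,≥ ≤⁺-trans ≤-trans [ ≤-reflexive (≈-sym (-‿inverseˡ ⌊ π σ ⌋)) ] (+⁺-mono (bound (X σ)) ≤⁺-refl)

  syntax addPotential π X = X +ₚ π

  _−ₚ_ : 𝕋 → (π : Potential) → 𝔸 π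
  (f −ₚ π) σ = (val (f σ) +⁺ [ - ⌊ π σ ⌋ ])
    ,≥ ≤⁺-trans ≤-trans [ ≤-reflexive (≈-sym (+-identityˡ _)) ] (+⁺-mono (bound (f σ)) ≤⁺-refl)

  aert : (π : Potential) → Program → 𝔸 π → 𝔸 π
  aert π (tick e)                X (s , h) = ℕ∞ (e s) ⊞ X (s , h)
  aert π C@(x ≔ e)               X = ert C (X +ₚ π) −ₚ π
  aert π C@(x ≔alloc e)          X = ert C (X +ₚ π) −ₚ π
  aert π C@(⟨ e ⟩≔ e′)           X = ert C (X +ₚ π) −ₚ π
  aert π C@(x ≔⟨ e ⟩)            X = ert C (X +ₚ π) −ₚ π
  aert π C@(free e)              X = ert C (X +ₚ π) −ₚ π
  aert π (｛ C₁ ｝⟦ p ⟧｛ C₂ ｝)   X = p · aert π C₁ X +[1−]· aert π C₂ X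
  aert π (if φ then C₁ else C₂)  X = [ φ ]· aert π C₁ X +[¬]· aert π C₂ X
  aert π (C₁ ⨾ C₂)               X = aert π C₁ (aert π C₂ X)
  aert π (while φ C)             X = lfp λ Y → [ φ ]· aert π C Y +[¬]· X

  ⋀-mono : ∀ {b} {I : Set} (f g : I → [ b ,∞]) → (∀ i → f i ⊑ g i) → ⋀ f ⊑ ⋀ g
  ⋀-mono f g f⊑g = ⋀-greatest g (⋀ f) λ i → ≤⁺-trans ≤-trans (⋀-lower f i) (f⊑g i)

  ⋁-mono : ∀ {b} {I : Set} (f g : I → [ b ,∞]) → (∀ i → f i ⊑ g i) → ⋁ f ⊑ ⋁ g
  ⋁-mono f g f⊑g = ⋁-least f (⋁ g) λ i → ≤⁺-trans ≤-trans (f⊑g i) (⋁-upper g i)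

  ⊕-monoʳ : ∀ f → Monotone (f ⊕_)
  ⊕-monoʳ f g g′ p (s , h) =
    ⋀-mono _ _ λ (h₁ , h₂ , _) → +⁺-mono (≤⁺-refl {val (f (s , h₁))}) (p (s , h₂))

  −⊖-monoʳ : ∀ f → Monotone (f −⊖_)
  −⊖-monoʳ f g g′ p (s , h) =
    ⋁-mono (λ (h′ , _) → g (s , h ⋆ h′) ∸ f (s , h′)) (λ (h′ , _) → g′ (s , h ⋆ h′) ∸ f (s , h′))
      λ (h′ , _) → ∸⁺-monoˡ (val (f (s , h′))) (p (s , h ⋆ h′))

  inf-mono : ∀ F G → (∀ v → F v ≼ G v) → inf F ≼ inf G
  inf-mono F G p σ = ⋀-mono (λ v → F v σ) (λ v → G v σ) λ v → p v σ

  sup-mono : ∀ F G → (∀ v → F v ≼ G v) → sup F ≼ sup G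
  sup-mono F G p σ = ⋁-mono (λ v → F v σ) (λ v → G v σ) λ v → p v σ

  [/]-mono : ∀ x e → Monotone _[ x / e ]
  [/]-mono x e f g p (s , h) = p (s [ x ]≔ e s , h)

  choice-mono : ∀ {ℓ} q (f f′ g g′ : Above ℓ) → f ≼ f′ → g ≼ g′ →
                (q · f +[1−]· g) ≼ (q · f′ +[1−]· g′)
  choice-mono q _ _ _ _ f≼ g≼ (s , h) =
    +⁺-mono (·⁺-mono (prob (q s)) (f≼ (s , h))) (·⁺-mono (1− q s) (g≼ (s , h)))

  cond-mono : ∀ {ℓ} φ (f f′ g g′ : Above ℓ) → f ≼ f′ → g ≼ g′ →
              ([ φ ]· f +[¬]· g) ≼ ([ φ ]· f′ +[¬]· g′)
  cond-mono φ _ _ _ _ f≼ g≼ (s , h) =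
    +⁺-mono (·⁺-mono (iverson (φ s)) (f≼ (s , h))) (·⁺-mono (iverson (not (φ s))) (g≼ (s , h)))

  lfp-mono : ∀ {ℓ} (Φ Ψ : Above ℓ → Above ℓ) → (∀ f → Φ f ≼ Ψ f) → lfp Φ ≼ lfp Ψ
  lfp-mono Φ Ψ Φ≼Ψ σ = ⋀-greatest _ (lfp Φ σ) λ (g , Ψg≼g) →
    ⋀-lower _ (g , λ τ → ≤⁺-trans ≤-trans (Φ≼Ψ g τ) (Ψg≼g τ))

  ert-mono : ∀ C → Monotone (ert C)
  ert-mono (tick e)      f g p = ⊕-monoʳ (tm e) f g p
  ert-mono (x ≔ e)       f g p = [/]-mono x e f g p
  ert-mono (x ≔alloc e)  f g p =
    sup-mono (λ v → cells v −⊖ f [ x / const v ]) (λ v → cells v −⊖ g [ x / const v ])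
      λ v → −⊖-monoʳ (cells v) (f [ x / const v ]) (g [ x / const v ]) ([/]-mono x (const v) f g p)
    where
    cells : ℕ → 𝕋
    cells v = ⨁ e λ i → [ const (v ℕ.+ i ℕ.∸ 1) ↦ const 0 ]
  ert-mono (⟨ e ⟩≔ e′)   f g p = ⊕-monoʳ [ e ↦-] ([ e ↦ e′ ] −⊖ f) ([ e ↦ e′ ] −⊖ g)
                           (−⊖-monoʳ [ e ↦ e′ ] f g p)
  ert-mono (x ≔⟨ e ⟩)    f g p = inf-mono _ _ λ v →
    ⊕-monoʳ [ e ↦ const v ] ([ e ↦ const v ] −⊖ f [ x / const v ]) ([ e ↦ const v ] −⊖ g [ x / const v ])
      (−⊖-monoʳ [ e ↦ const v ] (f [ x / const v ]) (g [ x / const v ])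
        ([/]-mono x (const v) f g p))
  ert-mono (free e)      f g p = ⊕-monoʳ [ e ↦-] f g p
  ert-mono (｛ C₁ ｝⟦ q ⟧｛ C₂ ｝) f g p =
    choice-mono q (ert C₁ f) (ert C₁ g) (ert C₂ f) (ert C₂ g) (ert-mono C₁ f g p) (ert-mono C₂ f g p)
  ert-mono (if φ then C₁ else C₂) f g p =
    cond-mono φ (ert C₁ f) (ert C₁ g) (ert C₂ f) (ert C₂ g) (ert-mono C₁ f g p) (ert-mono C₂ f g p)
  ert-mono (C₁ ⨾ C₂)     f g p = ert-mono C₁ (ert C₂ f) (ert C₂ g) (ert-mono C₂ f g p)
  ert-mono (while φ C)   f g p = lfp-mono (λ k → [ φ ]· ert C k +[¬]· f) (λ k → [ φ ]· ert C k +[¬]· g) λ k →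
    cond-mono φ (ert C k) (ert C k) f g (λ _ → ≤⁺-refl) p

  ert-lfp : ∀ φ C f → IsLeastFixedPoint (λ g → [ φ ]· ert C g +[¬]· f) (ert (while φ C) f)
  ert-lfp φ C f = lfp-isLeastFixedPoint (λ g → [ φ ]· ert C g +[¬]· f) λ g g′ p →
    cond-mono φ (ert C g) (ert C g′) f f (ert-mono C g g′ p) (λ _ → ≤⁺-refl)

  conj-mono : ∀ π C → Monotone (λ X → ert C (X +ₚ π) −ₚ π)
  conj-mono π C X Y p σ =
    +⁺-mono (ert-mono C (X +ₚ π) (Y +ₚ π) (λ τ → +⁺-mono (p τ) ≤⁺-refl) σ) ≤⁺-refl

  aert-mono : ∀ π C → Monotone (aert π C)
  aert-mono π (tick e)       X Y p (s , h) = +⁺-mono (≤⁺-refl {[ fromℕ (e s) ]}) (p (s , h))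
  aert-mono π C@(x ≔ e)      X Y p = conj-mono π C X Y p
  aert-mono π C@(x ≔alloc e) X Y p = conj-mono π C X Y p
  aert-mono π C@(⟨ e ⟩≔ e′)  X Y p = conj-mono π C X Y p
  aert-mono π C@(x ≔⟨ e ⟩)   X Y p = conj-mono π C X Y p
  aert-mono π C@(free e)     X Y p = conj-mono π C X Y p
  aert-mono π (｛ C₁ ｝⟦ q ⟧｛ C₂ ｝) X Y p =
    choice-mono q (aert π C₁ X) (aert π C₁ Y) (aert π C₂ X) (aert π C₂ Y)
                (aert-mono π C₁ X Y p) (aert-mono π C₂ X Y p)
  aert-mono π (if φ then C₁ else C₂) X Y p =
    cond-mono φ (aert π C₁ X) (aert π C₁ Y) (aert π C₂ X) (aert π C₂ Y)
              (aert-mono π C₁ X Y p) (aert-mono π C₂ X Y p)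
  aert-mono π (C₁ ⨾ C₂)      X Y p = aert-mono π C₁ (aert π C₂ X) (aert π C₂ Y) (aert-mono π C₂ X Y p)
  aert-mono π (while φ C)    X Y p = lfp-mono (λ Z → [ φ ]· aert π C Z +[¬]· X) (λ Z → [ φ ]· aert π C Z +[¬]· Y) λ Z →
    cond-mono φ (aert π C Z) (aert π C Z) X Y (λ _ → ≤⁺-refl) p

  aert-lfp : ∀ π φ C X →
             IsLeastFixedPoint (λ Y → [ φ ]· aert π C Y +[¬]· X) (aert π (while φ C) X)
  aert-lfp π φ C X = lfp-isLeastFixedPoint (λ Y → [ φ ]· aert π C Y +[¬]· X) λ Y Y′ p →
    cond-mono φ (aert π C Y) (aert π C Y′) X X (aert-mono π C Y Y′ p) (λ _ → ≤⁺-refl)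

{-# OPTIONS --safe #-}
module Submission where

-- Adding π is an order isomorphism from 𝔸 π onto 𝕋 with inverse subtraction of
-- π.  A convex combination commutes with the shift because its weights add up
-- to 1, and prefixed points correspond under the isomorphism, so meets of
-- prefixed points do too.  Among the primitive statements only tick is not
-- conjugated by definition; there tm(e) forces the empty heap on the left of the
-- splitting.

open import Algebra.Bundles using (CommutativeRing)
import Algebra.Properties.CommutativeSemigroup as CommutativeSemigroupProperties
open import Axiom.ExcludedMiddle using (ExcludedMiddle)
open import Data.Empty using (⊥-elim)
open import Data.Nat.Base using (ℕ)
open import Data.Product.Base using (_,_)
open import Level using (0ℓ)
open import Relation.Binary.Bundles using (Setoid)
open import Relation.Binary.PropositionalEquality using (_≡_; refl)
open import Relation.Binary.Structures using (IsTotalOrder)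
import Relation.Binary.Construct.Add.Supremum.Equality as SupremumEquality
import Relation.Binary.Reasoning.Setoid as SetoidReasoning
open import Relation.Nullary using (yes; no)
open import Relation.Nullary.Construct.Add.Supremum using ([_])
open import Defs

module _ (em : ExcludedMiddle 0ℓ) (𝓡 : CompleteOrderedField) (n : ℕ) where

  open Runtimes em 𝓡 n
  open CompleteOrderedField 𝓡
  open CommutativeRing commutativeRing
    using (+-cong; +-assoc; +-identityʳ; -‿inverseˡ; -‿inverseʳ;
           *-cong; *-identityˡ; zeroˡ; distribˡ; distribʳ; isEquivalence)
    renaming (refl to ≈-refl; sym to ≈-sym; trans to ≈-trans)
  open CommutativeSemigroupProperties
    (CommutativeRing.+-commutativeSemigroup commutativeRing) using (interchange)
  open IsTotalOrder isTotalOrder using ()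
    renaming (reflexive to ≤-reflexive; trans to ≤-trans; antisym to ≤-antisym)

  ≈⁺-setoid : Setoid 0ℓ 0ℓ
  ≈⁺-setoid = record { isEquivalence = SupremumEquality.≈⁺-isEquivalence _≈_ isEquivalence }

  open Setoid ≈⁺-setoid using ()
    renaming (refl to ≈⁺-refl; sym to ≈⁺-sym; trans to ≈⁺-trans)

  ≈⁺⇒≤⁺ : ∀ {x y} → x ≈⁺ y → x ≤⁺ y
  ≈⁺⇒≤⁺ = ≤⁺-reflexive ≤-reflexive

  -- The next five are stated for the underlying ℝ∞-valued functions because
  -- f ≼ g and f ≐ g mention only values, so that f and g could not be inferred.
  module _ {A : Set} {x y : A → ℝ∞} where

    ≐⇒≼ : (∀ a → x a ≈⁺ y a) → ∀ a → x a ≤⁺ y a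
    ≐⇒≼ x≐y a = ≈⁺⇒≤⁺ (x≐y a)

    ≐⇒≽ : (∀ a → x a ≈⁺ y a) → ∀ a → y a ≤⁺ x a
    ≐⇒≽ x≐y a = ≈⁺⇒≤⁺ (≈⁺-sym (x≐y a))

    ≼-antisym : (∀ a → x a ≤⁺ y a) → (∀ a → y a ≤⁺ x a) → ∀ a → x a ≈⁺ y a
    ≼-antisym x≼y y≼x a = ≤⁺-antisym ≤-antisym (x≼y a) (y≼x a)

    module _ {z : A → ℝ∞} where

      ≼-trans : (∀ a → x a ≤⁺ y a) → (∀ a → y a ≤⁺ z a) → ∀ a → x a ≤⁺ z a
      ≼-trans x≼y y≼z a = ≤⁺-trans ≤-trans (x≼y a) (y≼z a)

      ≐-trans : (∀ a → x a ≈⁺ y a) → (∀ a → y a ≈⁺ z a) → ∀ a → x a ≈⁺ z a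
      ≐-trans x≐y y≐z a = ≈⁺-trans (x≐y a) (y≐z a)

  -- Pointwise setoid equality is not respected by an arbitrary `Φ`; for a monotone one it follows
  -- by antisymmetry from the two inequalities.
  Monotone⇒cong : ∀ {ℓ ℓ′} (Φ : Above ℓ → Above ℓ′) → Monotone Φ → ∀ f g → f ≐ g → Φ f ≐ Φ g
  Monotone⇒cong Φ mono f g f≐g = ≼-antisym (mono f g (≐⇒≼ f≐g)) (mono g f (≐⇒≽ f≐g))

  +⁺-cong : ∀ {w x y z} → w ≈⁺ x → y ≈⁺ z → w +⁺ y ≈⁺ x +⁺ z
  +⁺-cong ⊤⁺≈⊤⁺ q      = ⊤⁺≈⊤⁺
  +⁺-cong [ p ] ⊤⁺≈⊤⁺  = ⊤⁺≈⊤⁺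
  +⁺-cong [ p ] [ q ]  = [ +-cong p q ]

  ·⁺-cong : ∀ w {x y} → x ≈⁺ y → w ·⁺ x ≈⁺ w ·⁺ y
  ·⁺-cong w [ p ]  = [ *-cong ≈-refl p ]
  ·⁺-cong w ⊤⁺≈⊤⁺  = ≈⁺-refl

  +⁺-assoc : ∀ x y z → (x +⁺ y) +⁺ z ≈⁺ x +⁺ (y +⁺ z)
  +⁺-assoc ∞     y     z     = ⊤⁺≈⊤⁺
  +⁺-assoc [ x ] ∞     z     = ⊤⁺≈⊤⁺
  +⁺-assoc [ x ] [ y ] ∞     = ⊤⁺≈⊤⁺
  +⁺-assoc [ x ] [ y ] [ z ] = [ +-assoc x y z ]

  +⁺-identityʳ : ∀ x → x +⁺ [ 0# ] ≈⁺ x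
  +⁺-identityʳ ∞     = ⊤⁺≈⊤⁺
  +⁺-identityʳ [ x ] = [ +-identityʳ x ]

  +⁺-cancelʳ : ∀ x {p q} → p + q ≈ 0# → (x +⁺ [ p ]) +⁺ [ q ] ≈⁺ x
  +⁺-cancelʳ x {p} {q} p+q≈0 = begin
    (x +⁺ [ p ]) +⁺ [ q ] ≈⟨ +⁺-assoc x [ p ] [ q ] ⟩
    x +⁺ [ p + q ]        ≈⟨ +⁺-cong (≈⁺-refl {x}) [ p+q≈0 ] ⟩
    x +⁺ [ 0# ]           ≈⟨ +⁺-identityʳ x ⟩
    x                     ∎
    where open SetoidReasoning ≈⁺-setoid

  +⁺-interchange : ∀ x p y q → (x +⁺ [ p ]) +⁺ (y +⁺ [ q ]) ≈⁺ (x +⁺ y) +⁺ [ p + q ]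
  +⁺-interchange ∞     p y     q = ⊤⁺≈⊤⁺
  +⁺-interchange [ x ] p ∞     q = ⊤⁺≈⊤⁺
  +⁺-interchange [ x ] p [ y ] q = [ interchange x p y q ]

  -- The delicate case is weight zero at `∞`: the convention 0 · ∞ = 0 turns the left side into 0,
  -- and the right side agrees because `⌊ w ⌋ * p` vanishes too.
  ·⁺-distribˡ-+⁺ : ∀ w x p → w ·⁺ (x +⁺ [ p ]) ≈⁺ w ·⁺ x +⁺ [ ⌊ w ⌋ * p ]
  ·⁺-distribˡ-+⁺ w [ x ] p = [ distribˡ ⌊ w ⌋ x p ]
  ·⁺-distribˡ-+⁺ w ∞     p with em {⌊ w ⌋ ≈ 0#}
  ... | no _    = ⊤⁺≈⊤⁺
  ... | yes w≈0 = [ ≈-sym (≈-trans (+-cong ≈-refl (≈-trans (*-cong w≈0 ≈-refl) (zeroˡ p)))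
                                   (+-identityʳ 0#)) ]

  -- Serves both conditionals and probabilistic choice. Taking `x′` and `y′` only up to `≈⁺` lets
  -- induction hypotheses be supplied directly.
  convex-shift : ∀ w w′ → ⌊ w ⌋ + ⌊ w′ ⌋ ≈ 1# → ∀ {x x′ y y′} p →
                 x′ ≈⁺ x +⁺ [ p ] → y′ ≈⁺ y +⁺ [ p ] →
                 w ·⁺ x′ +⁺ w′ ·⁺ y′ ≈⁺ (w ·⁺ x +⁺ w′ ·⁺ y) +⁺ [ p ]
  convex-shift w w′ w+w′≈1 {x} {x′} {y} {y′} p x′≈ y′≈ = begin
    w ·⁺ x′ +⁺ w′ ·⁺ y′
      ≈⟨ +⁺-cong (·⁺-cong w x′≈) (·⁺-cong w′ y′≈) ⟩
    w ·⁺ (x +⁺ [ p ]) +⁺ w′ ·⁺ (y +⁺ [ p ])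
      ≈⟨ +⁺-cong (·⁺-distribˡ-+⁺ w x p) (·⁺-distribˡ-+⁺ w′ y p) ⟩
    (w ·⁺ x +⁺ [ ⌊ w ⌋ * p ]) +⁺ (w′ ·⁺ y +⁺ [ ⌊ w′ ⌋ * p ])
      ≈⟨ +⁺-interchange (w ·⁺ x) _ (w′ ·⁺ y) _ ⟩
    (w ·⁺ x +⁺ w′ ·⁺ y) +⁺ [ ⌊ w ⌋ * p + ⌊ w′ ⌋ * p ]
      ≈⟨ +⁺-cong (≈⁺-refl {w ·⁺ x +⁺ w′ ·⁺ y}) [ weights ] ⟩
    (w ·⁺ x +⁺ w′ ·⁺ y) +⁺ [ p ] ∎
    where
    open SetoidReasoning ≈⁺-setoid
    weights : ⌊ w ⌋ * p + ⌊ w′ ⌋ * p ≈ p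
    weights = ≈-trans (≈-sym (distribʳ p ⌊ w ⌋ ⌊ w′ ⌋))
                      (≈-trans (*-cong w+w′≈1 ≈-refl) (*-identityˡ p))

  tm-∅ : ∀ e s → tm e (s , ∅) ⊑ ℕ∞ (e s)
  tm-∅ e s with em {∅ ≡ ∅}
  ... | yes _  = ≤⁺-refl
  ... | no ∅≢∅ = ⊥-elim (∅≢∅ refl)

  -- The infimum over splittings is attained where the left part is empty; every other splitting
  -- contributes `∞`.
  tm-⊕ : ∀ e f s h → val ((tm e ⊕ f) (s , h)) ≈⁺ [ fromℕ (e s) ] +⁺ val (f (s , h))
  tm-⊕ e f s h = ≤⁺-antisym ≤-antisym below above
    where
    below : val ((tm e ⊕ f) (s , h)) ≤⁺ [ fromℕ (e s) ] +⁺ val (f (s , h))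
    -- The splitting is `∅` and `h`: disjoint since `∅` has no locations, and `∅ ⋆ h` computes to
    -- `h`.
    below = ≤⁺-trans ≤-trans (⋀-lower _ (∅ , h , (λ { l ((v , ()) , _) }) , refl))
                             (+⁺-mono (tm-∅ e s) ≤⁺-refl)
    split : ∀ h₁ h₂ → h ≡ h₁ ⋆ h₂ → (ℕ∞ (e s) ⊞ f (s , h)) ⊑ (tm e (s , h₁) ⊞ f (s , h₂))
    split h₁ h₂ eq with em {h₁ ≡ ∅} | eq
    -- With `h₁` empty, `h₁ ⋆ h₂` computes to `h₂`, so the equation identifies `h` with `h₂`.
    ... | yes refl | refl = ≤⁺-refl
    ... | no _     | _    = _ ≤⊤⁺
    above : [ fromℕ (e s) ] +⁺ val (f (s , h)) ≤⁺ val ((tm e ⊕ f) (s , h))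
    above = ⋀-greatest _ (ℕ∞ (e s) ⊞ f (s , h)) λ (h₁ , h₂ , _ , eq) → split h₁ h₂ eq

  module _ (π : Potential) where

    +ₚ-mono : Monotone (λ X → X +ₚ π)
    +ₚ-mono X Y X≼Y σ = +⁺-mono (X≼Y σ) ≤⁺-refl

    −ₚ-mono : Monotone (λ f → f −ₚ π)
    −ₚ-mono f g f≼g σ = +⁺-mono (f≼g σ) ≤⁺-refl

    −ₚ∘+ₚ : ∀ X → ((X +ₚ π) −ₚ π) ≐ X
    −ₚ∘+ₚ X σ = +⁺-cancelʳ (val (X σ)) (-‿inverseʳ ⌊ π σ ⌋)

    +ₚ∘−ₚ : ∀ f → ((f −ₚ π) +ₚ π) ≐ f
    +ₚ∘−ₚ f σ = +⁺-cancelʳ (val (f σ)) (-‿inverseˡ ⌊ π σ ⌋)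

    lfp-conjugate : (Φ : 𝕋 → 𝕋) (Ψ : 𝔸 π → 𝔸 π) → Monotone Φ →
                    (∀ Y → Ψ Y ≐ (Φ (Y +ₚ π) −ₚ π)) → lfp Ψ ≐ (lfp Φ −ₚ π)
    lfp-conjugate Φ Ψ mono conj = ≼-antisym
      -- The greatest-lower-bound property needs the bare meet `lfp Φ` on the right, so π is first
      -- moved to the left and subtracted afterwards.
      (≼-trans (≐⇒≽ (−ₚ∘+ₚ (lfp Ψ))) (−ₚ-mono (lfp Ψ +ₚ π) (lfp Φ) Ψ-below))
      (λ σ → ⋀-greatest _ ((lfp Φ −ₚ π) σ) λ (Y , ΨY≼Y) → Φ-below Y ΨY≼Y σ)
      where
      -- Shifting `g` down and up again returns `g` only up to `≐`; monotonicity of `Φ` carries this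
      -- through.
      Ψ-prefixed : ∀ g → Φ g ≼ g → Ψ (g −ₚ π) ≼ (g −ₚ π)
      Ψ-prefixed g Φg≼g = ≼-trans (≐⇒≼ (conj (g −ₚ π)))
        (−ₚ-mono (Φ ((g −ₚ π) +ₚ π)) g (≼-trans (mono ((g −ₚ π) +ₚ π) g (≐⇒≼ (+ₚ∘−ₚ g))) Φg≼g))

      Φ-prefixed : ∀ Y → Ψ Y ≼ Y → Φ (Y +ₚ π) ≼ (Y +ₚ π)
      Φ-prefixed Y ΨY≼Y = ≼-trans (≐⇒≽ (+ₚ∘−ₚ (Φ (Y +ₚ π))))
        (+ₚ-mono (Φ (Y +ₚ π) −ₚ π) Y (≼-trans (≐⇒≽ (conj Y)) ΨY≼Y))

      Ψ-below : (lfp Ψ +ₚ π) ≼ lfp Φ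
      Ψ-below σ = ⋀-greatest _ ((lfp Ψ +ₚ π) σ) λ (g , Φg≼g) →
        ≼-trans (+ₚ-mono (lfp Ψ) (g −ₚ π) (λ τ → ⋀-lower _ (g −ₚ π , Ψ-prefixed g Φg≼g)))
                (≐⇒≼ (+ₚ∘−ₚ g)) σ

      Φ-below : ∀ Y → Ψ Y ≼ Y → (lfp Φ −ₚ π) ≼ Y
      Φ-below Y ΨY≼Y = ≼-trans
        (−ₚ-mono (lfp Φ) (Y +ₚ π) (λ τ → ⋀-lower _ (Y +ₚ π , Φ-prefixed Y ΨY≼Y)))
        (≐⇒≼ (−ₚ∘+ₚ Y))

    cond-shift : ∀ φ (X Y : 𝔸 π) f g → X ≐ (f −ₚ π) → Y ≐ (g −ₚ π) →
                 ([ φ ]· X +[¬]· Y) ≐ (([ φ ]· f +[¬]· g) −ₚ π)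
    cond-shift φ X Y f g X≐ Y≐ σ@(s , _) =
      convex-shift (iverson (φ s)) _ (iverson-sum (φ s)) (- ⌊ π σ ⌋) (X≐ σ) (Y≐ σ)

    choice-shift : ∀ p (X Y : 𝔸 π) f g → X ≐ (f −ₚ π) → Y ≐ (g −ₚ π) →
                   (p · X +[1−]· Y) ≐ ((p · f +[1−]· g) −ₚ π)
    choice-shift p X Y f g X≐ Y≐ σ@(s , _) =
      convex-shift (prob (p s)) (1− p s) (prob-sum (p s)) (- ⌊ π σ ⌋) (X≐ σ) (Y≐ σ)

    aert≐ert : ∀ C X → aert π C X ≐ (ert C (X +ₚ π) −ₚ π)
    aert≐ert (tick e) X σ@(s , h) = ≈⁺-sym (begin
      val ((tm e ⊕ (X +ₚ π)) σ) +⁺ [ - ⌊ π σ ⌋ ]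
        ≈⟨ +⁺-cong (tm-⊕ e (X +ₚ π) s h) ≈⁺-refl ⟩
      ([ fromℕ (e s) ] +⁺ val ((X +ₚ π) σ)) +⁺ [ - ⌊ π σ ⌋ ]
        ≈⟨ +⁺-assoc [ fromℕ (e s) ] (val ((X +ₚ π) σ)) [ - ⌊ π σ ⌋ ] ⟩
      [ fromℕ (e s) ] +⁺ val (((X +ₚ π) −ₚ π) σ)
        ≈⟨ +⁺-cong (≈⁺-refl {[ fromℕ (e s) ]}) (−ₚ∘+ₚ X σ) ⟩
      [ fromℕ (e s) ] +⁺ val (X σ) ∎)
      where open SetoidReasoning ≈⁺-setoid
    aert≐ert (x ≔ e)      X σ = ≈⁺-refl
    aert≐ert (x ≔alloc e) X σ = ≈⁺-refl
    aert≐ert (⟨ e ⟩≔ e′)  X σ = ≈⁺-refl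
    aert≐ert (x ≔⟨ e ⟩)   X σ = ≈⁺-refl
    aert≐ert (free e)     X σ = ≈⁺-refl
    aert≐ert (｛ C₁ ｝⟦ p ⟧｛ C₂ ｝) X =
      choice-shift p (aert π C₁ X) (aert π C₂ X) (ert C₁ (X +ₚ π)) (ert C₂ (X +ₚ π))
        (aert≐ert C₁ X) (aert≐ert C₂ X)
    aert≐ert (if φ then C₁ else C₂) X =
      cond-shift φ (aert π C₁ X) (aert π C₂ X) (ert C₁ (X +ₚ π)) (ert C₂ (X +ₚ π))
        (aert≐ert C₁ X) (aert≐ert C₂ X)
    -- The hypothesis for `C₁` is used at `Y`. The inner subtraction and addition of π then cancel,
    -- leaving `ert C₁` applied to `f`.
    aert≐ert (C₁ ⨾ C₂) X = ≐-trans (aert≐ert C₁ Y)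
      (Monotone⇒cong (λ g → ert C₁ g −ₚ π)
        (λ g g′ g≼g′ → −ₚ-mono (ert C₁ g) (ert C₁ g′) (ert-mono C₁ g g′ g≼g′)) (Y +ₚ π) f
        (≐-trans (Monotone⇒cong (λ Z → Z +ₚ π) +ₚ-mono Y (f −ₚ π) (aert≐ert C₂ X)) (+ₚ∘−ₚ f)))
      where
      Y = aert π C₂ X
      f = ert C₂ (X +ₚ π)
    aert≐ert (while φ C) X = lfp-conjugate
      (λ g → [ φ ]· ert C g +[¬]· (X +ₚ π)) (λ Y → [ φ ]· aert π C Y +[¬]· X)
      (λ f g f≼g → cond-mono φ (ert C f) (ert C g) (X +ₚ π) (X +ₚ π)
                     (ert-mono C f g f≼g) (λ _ → ≤⁺-refl))
      -- The induction hypothesis for the body is needed at every candidate `Y`. The exit branch `X`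
      -- is written as `(X +ₚ π) −ₚ π` so that both branches are shifts.
      (λ Y → cond-shift φ (aert π C Y) X (ert C (Y +ₚ π)) (X +ₚ π)
               (aert≐ert C Y) (λ σ → ≈⁺-sym (−ₚ∘+ₚ X σ)))

mainTheorem1 : (em : ExcludedMiddle 0ℓ) (𝓡 : CompleteOrderedField) (n : ℕ) →
    let open Runtimes em 𝓡 n in
    (π : Potential) (C : Program) (X : 𝔸 π) →
    aert π C X ≐ (ert C (X +ₚ π) −ₚ π)
mainTheorem1 = aert≐ert
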